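{- Let $k\ge 1$ be an integer and let $0<\varepsilon<1/2$. Put $\delta:=\varepsilon/2$ and $n_0:=2k/\varepsilon$. If $G$ is a $C_{2k+1}$-free graph on $n\ge n_0$ vertices with $e(G)\ge \left(\frac14-\delta\right)n^2$, then $G$ can be made bipartite by deleting at most $\varepsilon n^2$ edges.
   Context: All graphs are finite and simple; $e(G)$ is the number of edges of $G$. $C_{2k+1}$ is the cycle on $2k+1$ vertices. A graph is $F$-free if it does not contain a (not necessarily induced) subgraph isomorphic to $F$. -}

module Defs where

open import Level using (Level; 0ℓ; _⊔_) renaming (suc to lsuc)
open import Data.Bool.Base using (Bool)
open import Data.Nat.Base as ℕ using (ℕ; zero; suc; NonZero)
import Data.Nat.Properties as ℕₚ
open import Data.Fin.Base as Fin using (Fin; toℕ)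
import Data.Fin.Properties as Finₚ
open import Data.List.Base using (List; length; filter; allFin; cartesianProduct)
open import Data.Product.Base using (_×_; _,_; ∃; ∃-syntax; proj₁; proj₂)
open import Data.Sum.Base using (_⊎_; inj₁; inj₂; swap)
open import Function.Base using (_∘_)
open import Function.Definitions using (Injective)
open import Relation.Binary.Core using (Rel)
open import Relation.Binary.Definitions using (Decidable; Symmetric)
open import Relation.Binary.Structures using (IsStrictPartialOrder)
open import Relation.Binary.PropositionalEquality as ≡ using (_≡_; _≢_)
open import Relation.Nullary using (¬_; ¬?; _×-dec_; _⊎-dec_)
open import Algebra.Bundles using (CommutativeRing)
open import Algebra.Apartness.Bundles using (HeytingField)
import Algebra.Definitions.RawMonoid as RawMonoidDefs
import Algebra.Apartness.Properties.HeytingCommutativeRing as HeytingProps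

-- The standard library has no real numbers, so the real parameters range
-- over an arbitrary ordered field.  The axioms are constructive (apartness
-- instead of trichotomy): the rationals, the classical reals and the
-- constructive Dedekind or Cauchy reals all satisfy them.  Classically they
-- are equivalent to the usual axioms of an ordered field.
record OrderedField (c ℓ₁ ℓ₂ ℓ₃ : Level) : Set (lsuc (c ⊔ ℓ₁ ⊔ ℓ₂ ⊔ ℓ₃)) where
  field
    heytingField : HeytingField c ℓ₁ ℓ₂

  open HeytingField heytingField public

  infix 4 _<_
  field
    _<_                  : Rel Carrier ℓ₃
    isStrictPartialOrder : IsStrictPartialOrder _≈_ _<_
    #⇒<⊎>                : ∀ {x y} → x # y → x < y ⊎ y < x
    <⇒#                  : ∀ {x y} → x < y → x # y
    0<1                  : 0# < 1#
    +-monoˡ-<            : ∀ {x y} z → x < y → x + z < y + z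
    *-pos                : ∀ {x y} → 0# < x → 0# < y → 0# < x * y

  open IsStrictPartialOrder isStrictPartialOrder public
    using (<-resp-≈) renaming (irrefl to <-irrefl; trans to <-trans)

  infix 4 _≤_
  _≤_ : Rel Carrier ℓ₃
  x ≤ y = ¬ (y < x)

  commutativeRing : CommutativeRing c ℓ₁
  commutativeRing = record { isCommutativeRing = isCommutativeRing }

  open RawMonoidDefs (CommutativeRing.+-rawMonoid commutativeRing) public
    using () renaming (_×_ to _·_)

  fromℕ : ℕ → Carrier
  fromℕ n = n · 1#

  recip : ∀ x → 0# < x → Carrier
  recip x 0<x = proj₁ (#⇒invertible (#-sym (<⇒# 0<x)))

  -- #⇒invertible inverts x - 0#; this confirms that recip inverts x itself.
  recip-inverse : ∀ x (0<x : 0# < x) → x * recip x 0<x ≈ 1#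
  recip-inverse x 0<x =
    trans (*-congʳ (sym (x-0≈x x))) (proj₂ (proj₂ (#⇒invertible (#-sym (<⇒# 0<x)))))
    where
    open HeytingProps (HeytingField.heytingCommutativeRing heytingField)
      using (x-0≈x)

  0<fromℕ-suc : ∀ m → 0# < fromℕ (suc m)
  0<fromℕ-suc zero    = proj₁ <-resp-≈ (sym (+-identityʳ 1#)) 0<1
  0<fromℕ-suc (suc m) =
    <-trans (0<fromℕ-suc m)
      (proj₂ <-resp-≈ (+-identityˡ _) (+-monoˡ-< (fromℕ (suc m)) 0<1))

  infixl 7 _÷_[_] _/ℕ_

  _÷_[_] : Carrier → (y : Carrier) → 0# < y → Carrier
  x ÷ y [ 0<y ] = x * recip y 0<y

  _/ℕ_ : Carrier → (m : ℕ) .{{_ : NonZero m}} → Carrier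
  x /ℕ suc m = x ÷ fromℕ (suc m) [ 0<fromℕ-suc m ]

-- Finite simple graphs on the vertex set Fin n.
record Graph (n : ℕ) : Set₁ where
  field
    Adj    : Rel (Fin n) 0ℓ
    adj?   : Decidable Adj
    sym    : Symmetric Adj
    irrefl : ∀ {i} → ¬ Adj i i

open Graph

-- Each edge is listed once, as the pair (i , j) of its ends with i < j.
edges : ∀ {n} → Graph n → List (Fin n × Fin n)
edges {n} G =
  filter (λ (i , j) → (i Finₚ.<? j) ×-dec adj? G i j)
         (cartesianProduct (allFin n) (allFin n))

e : ∀ {n} → Graph n → ℕ
e G = length (edges G)

-- A copy of F in G, as a not necessarily induced subgraph, is the image of an
-- injective map that preserves adjacency.
Contains : ∀ {m n} → Graph m → Graph n → Set
Contains {m} {n} F G =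
  ∃[ φ ] Injective {A = Fin m} {B = Fin n} _≡_ _≡_ φ
       × (∀ {i j} → Adj F i j → Adj G (φ i) (φ j))

Free : ∀ {m n} → Graph m → Graph n → Set
Free F G = ¬ Contains F G

CyclicSuc : ∀ {m} → Rel (Fin m) 0ℓ
CyclicSuc {m} i j =
  suc (toℕ i) ≡ toℕ j ⊎ (suc (toℕ i) ≡ m × toℕ j ≡ 0)

cyclicSuc? : ∀ {m} → Decidable (CyclicSuc {m})
cyclicSuc? {m} i j =
  (suc (toℕ i) ℕₚ.≟ toℕ j) ⊎-dec ((suc (toℕ i) ℕₚ.≟ m) ×-dec (toℕ j ℕₚ.≟ 0))

-- The cycle C_m for m ≥ 3.  The conjunct i ≢ j only matters for m = 1, where
-- the unique vertex is its own cyclic successor.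
cycle : ∀ m → Graph m
cycle m = record
  { Adj    = λ i j → i ≢ j × (CyclicSuc i j ⊎ CyclicSuc j i)
  ; adj?   = λ i j → ¬? (i Finₚ.≟ j) ×-dec (cyclicSuc? i j ⊎-dec cyclicSuc? j i)
  ; sym    = λ (i≢j , s) → (i≢j ∘ ≡.sym) , swap s
  ; irrefl = λ (i≢i , _) → i≢i ≡.refl
  }

Bipartite : ∀ {n} → Graph n → Set
Bipartite {n} G =
  ∃ λ (side : Fin n → Bool) → ∀ {i j} → Adj G i j → side i ≢ side j

_⊆_ : ∀ {n} → Graph n → Graph n → Set
D ⊆ G = ∀ {i j} → Adj D i j → Adj G i j

-- Deletion from G of the edges of D; no vertex is removed.
_∖_ : ∀ {n} → Graph n → Graph n → Graph n
G ∖ D = record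
  { Adj    = λ i j → Adj G i j × ¬ Adj D i j
  ; adj?   = λ i j → adj? G i j ×-dec ¬? (adj? D i j)
  ; sym    = λ (g , d) → sym G g , (d ∘ sym D)
  ; irrefl = λ (g , _) → irrefl G g
  }

module Submission where

-- For a vertex v, delete the edges inside N(v) and inside its complement; say
-- D(v) of them.  Counting edges by their ends gives
--   D(v) + Σ_{i ∈ N(v)} d(i) = e(G) + 2 e(G[N(v)]).
-- A path on 2k vertices inside N(v) would close up through v to a C_{2k+1}, so
-- the Erdős–Gallai argument bounds e(G[N(v)]) by k d(v).  Averaging over v
-- (rather than taking v of maximum degree) and Cauchy–Schwarz give a v with
--   n² D(v) + 4 e² ≤ n² e + 4 k n e,   where e = e(G).
-- As ε < 1/2 and n ≥ 2k/ε, r = n − 4k is nonnegative; completing the square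
-- turns this into 4 n D(v) + 4 r e ≤ n³, and the lower bound on e together
-- with 2k ≤ ε n then yields D(v) ≤ ε n².

open import Defs
open import Level using (Level)
open import Data.Nat.Base as ℕ using (ℕ; zero; suc)
open import Data.Nat.Properties as ℕₚ using (m≤n⇒∃[o]m+o≡n; ≮⇒≥)
open import Data.Product.Base using (_×_; _,_; ∃₂; ∃-syntax; proj₁; proj₂)
open import Data.Sum.Base using (_⊎_; inj₁; inj₂)
open import Function.Base using (_∘_; id)
open import Relation.Binary.PropositionalEquality as ≡ using (_≡_)
open import Relation.Nullary using (Dec; yes; no; does; ¬_; contradiction; _×-dec_)

module Combinatorics where

  open import Level using (0ℓ)
  open import Data.Bool.Base using (Bool; if_then_else_)
  import Data.Bool.Properties as Boolₚ
  open import Data.Nat.Base using (_+_; _*_; _≤_; _<_; z≤n; s≤s)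
  open import Data.Nat.Properties
  open import Data.Nat.ListAction using (sum)
  open import Data.Nat.ListAction.Properties using (sum-++; sum-↭)
  open import Data.Nat.Tactic.RingSolver using (solve-∀)
  open import Data.Fin.Base as Fin using (Fin; toℕ)
  import Data.Fin.Properties as Finₚ
  open import Data.List.Base using (List; []; _∷_; _++_; map; filter; length; allFin; cartesianProduct; lookup; tabulate)
  open import Data.List.Properties using (map-cong; map-∘; map-++; length-++; length-tabulate)
  open import Data.List.Membership.Propositional using (_∈_; find)
  open import Data.List.Membership.Propositional.Properties using (∈-∃++; ∈-lookup)
  open import Data.List.Relation.Unary.All as All using (All; []; _∷_)
  import Data.List.Relation.Unary.All.Properties as Allₚ
  open import Data.List.Relation.Unary.AllPairs using ([]; _∷_)
  open import Data.List.Relation.Unary.Any using (Any; here; there; any?)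
  open import Data.List.Relation.Unary.Unique.Propositional using (Unique)
  import Data.List.Relation.Unary.Unique.Propositional.Properties as Uniqueₚ
  open import Data.List.Relation.Binary.Permutation.Propositional using (_↭_; prep; ↭-refl; ↭-trans; ↭⇒↭ₛ)
  open import Data.List.Relation.Binary.Permutation.Propositional.Properties as ↭ using (↭-length; shift; shifts; ++⁺ˡ; ++⁺ʳ; ++⁺)
  import Data.List.Relation.Binary.Permutation.Setoid.Properties as ↭ₛ
  open import Relation.Binary.Core using (Rel)
  open import Relation.Binary.Definitions using (Decidable; Symmetric; tri<; tri≈; tri>)
  open import Relation.Binary.PropositionalEquality using (_≢_; refl; cong; cong₂; subst)
  open import Relation.Unary using (Pred)
  import Relation.Unary as U

  -- Sums over lists and 0/1 indicators of decidable propositions.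

  private variable
    A B P Q : Set

  ∑ : List A → (A → ℕ) → ℕ
  ∑ xs f = sum (map f xs)

  𝟙 : Dec P → ℕ
  𝟙 p = if does p then 1 else 0

  𝟙≤1 : (p : Dec P) → 𝟙 p ≤ 1
  𝟙≤1 (yes _) = ≤-refl
  𝟙≤1 (no  _) = z≤n

  𝟙-false : (p : Dec P) → ¬ P → 𝟙 p ≡ 0
  𝟙-false (yes p) ¬p = contradiction p ¬p
  𝟙-false (no  _) _  = refl

  𝟙-cong : (p : Dec P) (q : Dec Q) → (P → Q) → (Q → P) → 𝟙 p ≡ 𝟙 q
  𝟙-cong (yes p) (yes q) _ _ = refl
  𝟙-cong (yes p) (no ¬q) f _ = contradiction (f p) ¬q
  𝟙-cong (no ¬p) (yes q) _ g = contradiction (g q) ¬p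
  𝟙-cong (no ¬p) (no ¬q) _ _ = refl

  +-interchange : ∀ a b c d → (a + b) + (c + d) ≡ (a + c) + (b + d)
  +-interchange = solve-∀

  ∑-cong : ∀ (xs : List A) {f g} → (∀ x → f x ≡ g x) → ∑ xs f ≡ ∑ xs g
  ∑-cong xs eq = cong sum (map-cong eq xs)

  ∑-mono-≤ : ∀ (xs : List A) {f g} → (∀ x → f x ≤ g x) → ∑ xs f ≤ ∑ xs g
  ∑-mono-≤ []       le = z≤n
  ∑-mono-≤ (x ∷ xs) le = +-mono-≤ (le x) (∑-mono-≤ xs le)

  ∑-distrib-+ : ∀ (xs : List A) f g → ∑ xs (λ x → f x + g x) ≡ ∑ xs f + ∑ xs g
  ∑-distrib-+ []       f g = refl
  ∑-distrib-+ (x ∷ xs) f g =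
    ≡.trans (cong (f x + g x +_) (∑-distrib-+ xs f g)) (+-interchange (f x) (g x) (∑ xs f) (∑ xs g))

  ∑-distrib-* : ∀ (xs : List A) c f → ∑ xs (λ x → c * f x) ≡ c * ∑ xs f
  ∑-distrib-* []       c f = ≡.sym (*-zeroʳ c)
  ∑-distrib-* (x ∷ xs) c f =
    ≡.trans (cong (c * f x +_) (∑-distrib-* xs c f)) (≡.sym (*-distribˡ-+ c (f x) (∑ xs f)))

  ∑-const : ∀ (xs : List A) c → ∑ xs (λ _ → c) ≡ length xs * c
  ∑-const []       c = refl
  ∑-const (x ∷ xs) c = cong (c +_) (∑-const xs c)

  ∑-swap : ∀ (xs : List A) (ys : List B) (f : A → B → ℕ) →
           ∑ xs (λ x → ∑ ys (f x)) ≡ ∑ ys (λ y → ∑ xs (λ x → f x y))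
  ∑-swap []       ys f = ≡.sym (≡.trans (∑-const ys 0) (*-zeroʳ (length ys)))
  ∑-swap (x ∷ xs) ys f = ≡.trans (cong (∑ ys (f x) +_) (∑-swap xs ys f))
    (≡.sym (∑-distrib-+ ys (f x) (λ y → ∑ xs (λ x → f x y))))

  ∑-++ : ∀ (xs ys : List A) f → ∑ (xs ++ ys) f ≡ ∑ xs f + ∑ ys f
  ∑-++ xs ys f = ≡.trans (cong sum (map-++ f xs ys)) (sum-++ (map f xs) (map f ys))

  ∑-↭ : ∀ {xs ys : List A} f → xs ↭ ys → ∑ xs f ≡ ∑ ys f
  ∑-↭ f p = sum-↭ (↭.map⁺ f p)

  ∑-filter : ∀ {P : Pred A 0ℓ} (P? : U.Decidable P) xs f →
             ∑ (filter P? xs) f ≡ ∑ xs (λ x → 𝟙 (P? x) * f x)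
  ∑-filter P? []       f = refl
  ∑-filter P? (x ∷ xs) f with P? x
  ... | yes _ = cong₂ _+_ (≡.sym (+-identityʳ (f x))) (∑-filter P? xs f)
  ... | no  _ = ∑-filter P? xs f

  pick : ∀ {P : Pred A 0ℓ} {xs} → Any P xs → ∃₂ λ u ys → P u × xs ↭ u ∷ ys
  pick any with find any
  ... | u , u∈xs , pu with ∈-∃++ u∈xs
  ...   | ys , zs , refl = u , ys ++ zs , pu , shift u ys zs

  -- The Erdős-Gallai bound on the edges among vertices that span no long path.

  module ErdősGallai {V : Set} {Adj : Rel V 0ℓ} (adj? : Decidable Adj)
                     (adj-sym : Symmetric Adj) (adj-irrefl : ∀ {x} → ¬ Adj x x) where

    private variable
      x y z w p q : V
      S R Xs Ys : List V

    infixr 5 _∷_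
    -- The middle index lists the vertices in order. Distinctness is not demanded here; it is
    -- inherited from the ambient list of which the path takes up a part.
    data Path : V → List V → V → Set where
      [_] : ∀ x → Path x (x ∷ []) x
      _∷_ : Adj x y → Path y Ys z → Path x (x ∷ Ys) z

    _++⟨_⟩_ : Path x Xs y → Adj y z → Path z Ys w → Path x (Xs ++ Ys) w
    [ x ]   ++⟨ yz ⟩ q = yz ∷ q
    (e ∷ p) ++⟨ yz ⟩ q = e ∷ (p ++⟨ yz ⟩ q)

    reversed : Path x Xs y → ∃[ Ys ] (Xs ↭ Ys × Path y Ys x)
    reversed [ x ] = _ , ↭-refl , [ x ]
    reversed {x} (e ∷ p) with reversed p
    ... | Ys , perm , p′ = Ys ++ x ∷ [] , ↭-trans (prep x perm) (↭.∷↭∷ʳ x Ys) , p′ ++⟨ adj-sym e ⟩ [ x ]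

    end∈ : Path x Xs y → y ∈ Xs
    end∈ [ x ]   = here refl
    end∈ (_ ∷ p) = there (end∈ p)

    split : Path x Xs y → w ∈ Xs →
            w ≡ x ⊎ ∃₂ λ Ys Zs → ∃[ z ] (Xs ≡ Ys ++ Zs × Path x Ys z × Path w Zs y)
    split [ x ]   (here eq) = inj₁ eq
    split (_ ∷ _) (here eq) = inj₁ eq
    split {x} (e ∷ p) (there w∈) with split p w∈
    ... | inj₁ refl = inj₂ (_ , _ , _ , refl , [ x ] , p)
    ... | inj₂ (_ , _ , _ , refl , p₁ , p₂) = inj₂ (_ , _ , _ , refl , e ∷ p₁ , p₂)

    -- The edge from `y` back to `x` closes a cycle. Cut open just before `w`, it becomes the piece
    -- from `w` to `y` followed by the piece that preceded `w`.
    rotated : Path x Xs y → Adj y x → w ∈ Xs → ∃₂ λ Ys z → Xs ↭ Ys × Path w Ys z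
    rotated p yx w∈ with split p w∈
    ... | inj₁ refl = _ , _ , ↭-refl , p
    ... | inj₂ (Ys , Zs , _ , refl , p₁ , p₂) = _ , _ , ↭.++-comm Ys Zs , p₂ ++⟨ yx ⟩ p₁

    a : V → V → ℕ
    a x y = 𝟙 (adj? x y)

    deg : V → List V → ℕ
    deg x S = ∑ S (a x)

    -- e₂ S S is twice the number of edges inside S.
    e₂ : List V → List V → ℕ
    e₂ S R = ∑ S (λ x → deg x R)

    a-sym : ∀ x y → a x y ≡ a y x
    a-sym x y = 𝟙-cong (adj? x y) (adj? y x) adj-sym adj-sym

    a-diag : ∀ x → a x x ≡ 0
    a-diag x = 𝟙-false (adj? x x) adj-irrefl

    e₂-∷ : ∀ x S → e₂ (x ∷ S) (x ∷ S) ≡ 2 * deg x S + e₂ S S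
    e₂-∷ x S = begin
      a x x + deg x S + ∑ S (λ y → a y x + deg y S)
        ≡⟨ cong₂ (λ i j → i + deg x S + j) (a-diag x) (∑-distrib-+ S (λ y → a y x) (λ y → deg y S)) ⟩
      deg x S + (∑ S (λ y → a y x) + e₂ S S)
        ≡⟨ cong (λ i → deg x S + (i + e₂ S S)) (∑-cong S (λ y → a-sym y x)) ⟩
      deg x S + (deg x S + e₂ S S)
        ≡⟨ rearrange (deg x S) (e₂ S S) ⟩
      2 * deg x S + e₂ S S ∎
      where
      open ≡.≡-Reasoning
      rearrange : ∀ d b → d + (d + b) ≡ 2 * d + b
      rearrange = solve-∀

    e₂-++ : ∀ Q R → e₂ (Q ++ R) (Q ++ R) ≡ (e₂ Q Q + e₂ Q R) + (e₂ R Q + e₂ R R)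
    e₂-++ Q R = ≡.trans (∑-++ Q R _) (cong₂ _+_ (half Q) (half R))
      where
      half : ∀ S → ∑ S (λ x → deg x (Q ++ R)) ≡ e₂ S Q + e₂ S R
      half S = ≡.trans (∑-cong S (λ x → ∑-++ Q R (a x))) (∑-distrib-+ S (λ x → deg x Q) (λ x → deg x R))

    e₂-↭ : S ↭ R → e₂ S S ≡ e₂ R R
    e₂-↭ {S} p = ≡.trans (∑-cong S (λ x → ∑-↭ (a x) p)) (∑-↭ _ p)

    e₂-sym : ∀ S R → e₂ S R ≡ e₂ R S
    e₂-sym S R = ≡.trans (∑-swap S R a) (∑-cong R (λ y → ∑-cong S (λ x → a-sym x y)))

    -- Every ordered pair contributes at most 1. This crude bound suffices for a component with at
    -- most `m` vertices, which may use up `m` per vertex.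
    e₂≤length² : ∀ S → e₂ S S ≤ length S * length S
    e₂≤length² S = begin
      ∑ S (λ x → ∑ S (a x))      ≤⟨ ∑-mono-≤ S (λ x → ∑-mono-≤ S (λ y → 𝟙≤1 (adj? x y))) ⟩
      ∑ S (λ _ → ∑ S (λ _ → 1))  ≡⟨ ∑-const S _ ⟩
      length S * ∑ S (λ _ → 1)   ≡⟨ cong (length S *_) (≡.trans (∑-const S 1) (*-identityʳ _)) ⟩
      length S * length S        ∎
      where open ≤-Reasoning

    deg≡0 : ∀ R → ¬ Any (Adj x) R → deg x R ≡ 0
    deg≡0 []      _  = refl
    deg≡0 {x} (y ∷ R) ¬∃ = cong₂ _+_ (𝟙-false (adj? x y) (¬∃ ∘ here)) (deg≡0 R (¬∃ ∘ there))

    e₂≡0 : ∀ Q R → ¬ Any (λ x → Any (Adj x) R) Q → e₂ Q R ≡ 0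
    e₂≡0 []      R _  = refl
    e₂≡0 (x ∷ Q) R ¬∃ = cong₂ _+_ (deg≡0 R (¬∃ ∘ here)) (e₂≡0 Q R (¬∃ ∘ there))

    -- Bookkeeping for a new first vertex `z` in front of `w`, with `i`, `j`, `k` standing for
    -- `a x z`, `a x w`, `a y z`. The left side gains `i + k`; the right side trades `j` for `i` and
    -- gains 1. So `j + k ≤ 1` is what is required.
    crossing-step : ∀ i j k {l dx dy n} → j + k ≤ 1 → dx + dy < n + (j + l) →
                    (i + dx) + (k + dy) < suc n + (i + l)
    crossing-step i j k {l} {dx} {dy} {n} jk≤1 lt = begin
      suc ((i + dx) + (k + dy))  ≡⟨ eq₁ i k dx dy ⟩
      (i + k) + suc (dx + dy)    ≤⟨ +-monoʳ-≤ (i + k) lt ⟩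
      (i + k) + (n + (j + l))    ≡⟨ eq₂ i j k l n ⟩
      (j + k) + (n + (i + l))    ≤⟨ +-monoˡ-≤ _ jk≤1 ⟩
      suc n + (i + l)            ∎
      where
      open ≤-Reasoning
      eq₁ : ∀ i k dx dy → suc ((i + dx) + (k + dy)) ≡ (i + k) + suc (dx + dy)
      eq₁ = solve-∀
      eq₂ : ∀ i j k l n → (i + k) + (n + (j + l)) ≡ (j + k) + (n + (i + l))
      eq₂ = solve-∀

    -- A crossing of a path from x to y turns its vertices into a cycle.  In
    -- crossing the start z of the path is decoupled from x for the induction.
    Crossing : V → V → List V → V → Set
    Crossing x z Xs y = ∃₂ λ Ys Zs → ∃₂ λ p q →
      Xs ≡ Ys ++ Zs × Path z Ys p × Path q Zs y × Adj x q × Adj y p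

    -- Each consecutive pair `p`, `q` on the path contributes `a y p + a x q`, which is at most 1
    -- unless the pair is a crossing. The boundary terms `a x z` and `a y y` are left over, and
    -- there is one pair fewer than vertices, hence the strict inequality.
    crossing : ∀ x → Path z Xs y →
               Crossing x z Xs y ⊎ deg x Xs + deg y Xs < length Xs + (a x z + a y y)
    crossing x [ y ] = inj₂ (s≤s (≤-reflexive (rearrange (a x y) (a y y))))
      where
      rearrange : ∀ i j → (i + 0) + (j + 0) ≡ i + j
      rearrange = solve-∀
    crossing {z} {_} {y} x (_∷_ {y = w} {Ys = Xs} zw p) with crossing x p
    ... | inj₁ (_ , _ , _ , _ , refl , p₁ , p₂ , xq , yp) =
      inj₁ (_ , _ , _ , _ , refl , zw ∷ p₁ , p₂ , xq , yp)
    ... | inj₂ lt with adj? x w | adj? y z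
    -- The new pair `z`, `w` is itself the crossing, and its first segment is `z` alone.
    ...   | yes xw | yes yz = inj₁ (_ , _ , _ , _ , refl , [ z ] , p , xw , yz)
    ...   | yes _  | no _   = inj₂ (crossing-step (a x z) 1 0 {a y y} {n = length Xs} ≤-refl lt)
    ...   | no _   | yz?    = inj₂ (crossing-step (a x z) 0 (𝟙 yz?) {a y y} {n = length Xs} (𝟙≤1 yz?) lt)

    -- The permutation makes `Xs` a sub-multiset of `S` with `R` left over, so a path repeats no
    -- vertex if `S` has no repetition.
    NoPathOn : ℕ → List V → Set
    NoPathOn m S = ∀ {x y Xs R} → S ↭ Xs ++ R → Path x Xs y → length Xs ≢ m

    NoPathOn-rest : ∀ {m} Q → S ↭ Q ++ R → NoPathOn m S → NoPathOn m R
    NoPathOn-rest Q S↭ free {Xs = Xs} {R′} R↭ =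
      free (↭-trans S↭ (↭-trans (++⁺ˡ Q R↭) (shifts Q Xs)))

    -- The inductive step: it suffices to find a nonempty list of vertices whose removal lowers
    -- `e₂ S S` by at most `m` for each of them, since `ih` covers the remainder.
    module _ {m : ℕ} {S : List V} (free : NoPathOn m S)
             (ih : ∀ {q Q R} → S ↭ q ∷ Q ++ R → e₂ R R ≤ m * length R) where

      private
        Bound : Set
        Bound = e₂ S S ≤ m * length S

      discard : ∀ {q} Q R → S ↭ (q ∷ Q) ++ R →
                e₂ S S ≤ m * length (q ∷ Q) + e₂ R R → Bound
      discard {q} Q R S↭ le = begin
        e₂ S S                                ≤⟨ le ⟩
        m * length (q ∷ Q) + e₂ R R           ≤⟨ +-monoʳ-≤ _ (ih {Q = Q} {R} S↭) ⟩
        m * length (q ∷ Q) + m * length R     ≡⟨ *-distribˡ-+ m (length (q ∷ Q)) (length R) ⟨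
        m * (length (q ∷ Q) + length R)       ≡⟨ cong (m *_) (length-++ (q ∷ Q)) ⟨
        m * length ((q ∷ Q) ++ R)             ≡⟨ cong (m *_) (↭-length S↭) ⟨
        m * length S                          ∎
        where open ≤-Reasoning

      -- No edge joins `Xs` to `R`, so the cross terms vanish and only pairs inside `Xs` are lost,
      -- at most `length Xs ≤ m` for each vertex.
      discard-component : ∀ R → Path x Xs y → S ↭ Xs ++ R → length Xs ≤ m →
                          ¬ Any (λ w → Any (Adj w) R) Xs → Bound
      discard-component {Xs = Xs@(_ ∷ Xs′)} R _ S↭ ≤m isolated =
        discard Xs′ R S↭ (begin
        e₂ S S                                          ≡⟨ e₂-↭ S↭ ⟩
        e₂ (Xs ++ R) (Xs ++ R)                          ≡⟨ e₂-++ Xs R ⟩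
        (e₂ Xs Xs + e₂ Xs R) + (e₂ R Xs + e₂ R R)
          ≡⟨ cong₂ (λ i j → (e₂ Xs Xs + i) + (j + e₂ R R)) no-edges (≡.trans (e₂-sym R Xs) no-edges) ⟩
        (e₂ Xs Xs + 0) + e₂ R R                         ≡⟨ cong (_+ e₂ R R) (+-identityʳ _) ⟩
        e₂ Xs Xs + e₂ R R                               ≤⟨ +-monoˡ-≤ _ (e₂≤length² Xs) ⟩
        length Xs * length Xs + e₂ R R                  ≤⟨ +-monoˡ-≤ _ (*-monoˡ-≤ (length Xs) ≤m) ⟩
        m * length Xs + e₂ R R                          ∎)
        where
        open ≤-Reasoning
        no-edges = e₂≡0 Xs R isolated

      -- All neighbours of `x` and `y` in `S` lie on the path, so removing both ends lowers `e₂` by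
      -- at most twice the sum of their degrees. Without a crossing this is at most `2 * m`, that
      -- is, `m` for each end.
      discard-ends : ∀ R → Path x Xs y → S ↭ Xs ++ R → length Xs ≤ m →
                     ¬ Any (Adj x) R → ¬ Any (Adj y) R →
                     deg x Xs + deg y Xs < length Xs + (a x x + a y y) → Bound
      -- On a single vertex the two ends coincide; that vertex has no neighbour outside and is a
      -- component by itself.
      discard-ends R p@([ x ]) S↭ ≤m x¬ _ _ =
        discard-component R p S↭ ≤m λ { (here x~) → x¬ x~ }
      discard-ends {x} {Xs} {y} R (_∷_ {Ys = Ys} _ p) S↭ ≤m x¬ y¬ lt
        with pick (end∈ p)
      ... | _ , Ms , refl , Ys↭ =
        discard (y ∷ []) (Ms ++ R) S↭′ (begin
          e₂ S S                                              ≡⟨ e₂-↭ S↭′ ⟩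
          e₂ (x ∷ y ∷ M) (x ∷ y ∷ M)                          ≡⟨ e₂-∷ x (y ∷ M) ⟩
          2 * deg x (y ∷ M) + e₂ (y ∷ M) (y ∷ M)              ≡⟨ cong (2 * deg x (y ∷ M) +_) (e₂-∷ y M) ⟩
          2 * deg x (y ∷ M) + (2 * deg y M + e₂ M M)          ≡⟨ rearrange (deg x (y ∷ M)) (deg y M) (e₂ M M) ⟩
          2 * (deg x (y ∷ M) + deg y M) + e₂ M M
            -- Putting back `a x x`, `a y x` and `a y y` turns both sums into degrees over all of
            -- `S`.
            ≤⟨ +-monoˡ-≤ (e₂ M M) (*-monoʳ-≤ 2 (+-mono-≤ (m≤n+m _ (a x x)) (≤-trans (m≤n+m _ (a y y)) (m≤n+m _ (a y x))))) ⟩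
          2 * (deg x (x ∷ y ∷ M) + deg y (x ∷ y ∷ M)) + e₂ M M
            ≡⟨ cong₂ (λ i j → 2 * (i + j) + e₂ M M) (inside x¬) (inside y¬) ⟩
          2 * (deg x Xs + deg y Xs) + e₂ M M                  ≤⟨ +-monoˡ-≤ (e₂ M M) (*-monoʳ-≤ 2 (<⇒≤ lt)) ⟩
          2 * (length Xs + (a x x + a y y)) + e₂ M M
            ≡⟨ cong₂ (λ i j → 2 * (length Xs + (i + j)) + e₂ M M) (a-diag x) (a-diag y) ⟩
          2 * (length Xs + 0) + e₂ M M                        ≡⟨ cong (λ i → 2 * i + e₂ M M) (+-identityʳ (length Xs)) ⟩
          2 * length Xs + e₂ M M                              ≤⟨ +-monoˡ-≤ (e₂ M M) (*-monoʳ-≤ 2 ≤m) ⟩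
          2 * m + e₂ M M                                      ≡⟨ cong (_+ e₂ M M) (*-comm 2 m) ⟩
          m * 2 + e₂ M M                                      ∎)
        where
        open ≤-Reasoning
        M = Ms ++ R
        Xs↭ : Xs ++ R ↭ x ∷ y ∷ M
        Xs↭ = prep x (++⁺ʳ R Ys↭)
        S↭′ : S ↭ x ∷ y ∷ M
        S↭′ = ↭-trans S↭ Xs↭
        inside : ∀ {w} → ¬ Any (Adj w) R → deg w (x ∷ y ∷ M) ≡ deg w Xs
        inside {w} w¬ = begin-equality
          deg w (x ∷ y ∷ M)    ≡⟨ ∑-↭ (a w) Xs↭ ⟨
          deg w (Xs ++ R)      ≡⟨ ∑-++ Xs R (a w) ⟩
          deg w Xs + deg w R   ≡⟨ cong (deg w Xs +_) (deg≡0 R w¬) ⟩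
          deg w Xs + 0         ≡⟨ +-identityʳ _ ⟩
          deg w Xs             ∎
        rearrange : ∀ i j k → 2 * i + (2 * j + k) ≡ 2 * (i + j) + k
        rearrange = solve-∀

      -- The path is lengthened as long as an end, or any vertex of a cycle through
      -- all its vertices, has a neighbour outside it; fuel + length Xs = m.
      grow : ∀ fuel R → Path x Xs y → S ↭ Xs ++ R → fuel + length Xs ≡ m → Bound

      lengthen : ∀ fuel R {Ys v u} → Path v Ys u → Any (Adj v) R → Xs ↭ Ys →
                 S ↭ Xs ++ R → suc fuel + length Xs ≡ m → Bound
      lengthen {Xs} fuel R {Ys} p any Xs↭ S↭ len with pick any
      ... | u , R′ , v~u , R↭ =
        grow fuel R′ (adj-sym v~u ∷ p)
          (↭-trans S↭ (↭-trans (++⁺ Xs↭ R↭) (shift u Ys R′)))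
          (≡.trans (cong (λ l → fuel + suc l) (≡.sym (↭-length Xs↭))) (≡.trans (+-suc fuel (length Xs)) len))

      grow zero R p S↭ len = contradiction len (free S↭ p)
      grow {x} {Xs} {y} (suc fuel) R p S↭ len with any? (adj? x) R
      ... | yes x~ = lengthen fuel R p x~ ↭-refl S↭ len
      ... | no x¬ with any? (adj? y) R
      ...   | yes y~ = let _ , Xs↭ , p′ = reversed p in lengthen fuel R p′ y~ Xs↭ S↭ len
      ...   | no y¬ with crossing x p
      ...     | inj₂ lt = discard-ends R p S↭ (m+n≤o⇒n≤o (suc fuel) (≤-reflexive len)) x¬ y¬ lt
      -- Going back along the first segment from its end to `x`, over the edge `xq` and on to `y`
      -- visits every vertex of the path; the edge `yp` closes the cycle.
      ...     | inj₁ (_ , Zs , _ , _ , refl , p₁ , p₂ , xq , yp)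
                with reversed p₁
      ...     | Qs , perm , p₁′ with any? (λ w → any? (adj? w) R) (Qs ++ Zs)
      ...       | no isolated =
                    discard-component R (p₁′ ++⟨ xq ⟩ p₂) (↭-trans S↭ (++⁺ʳ R (++⁺ʳ Zs perm)))
                      (subst (_≤ m) (↭-length (++⁺ʳ Zs perm)) (m+n≤o⇒n≤o (suc fuel) (≤-reflexive len))) isolated
      ...       | yes any with find any
      ...         | w , w∈ , w~ with rotated (p₁′ ++⟨ xq ⟩ p₂) yp w∈
      ...           | _ , _ , perm′ , p′ =
                        lengthen fuel R p′ w~ (↭-trans (++⁺ʳ Zs perm) perm′) S↭ len

    -- Induction on a bound for the length of `S`, since the recursion passes to an arbitrary
    -- remainder. As `e₂` counts edges twice, excluding paths on l vertices leaves at most l/2 edges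
    -- per vertex; the sharp constant is (l - 2)/2 for l at least 2.
    erdős-gallai : ∀ m S → NoPathOn (suc m) S → e₂ S S ≤ suc m * length S
    erdős-gallai m S = go (length S) S ≤-refl
      where
      go : ∀ b S → length S ≤ b → NoPathOn (suc m) S → e₂ S S ≤ suc m * length S
      go b []      _ _ = z≤n
      go (suc b) (x ∷ S) (s≤s len) free =
        grow free
          (λ {_} {Q} {R} S↭ → go b R
            (≤-trans (m+n≤o⇒n≤o (length Q) (≤-reflexive (≡.trans (≡.sym (length-++ Q)) (suc-injective (≡.sym (↭-length S↭)))))) len)
            (NoPathOn-rest _ S↭ free))
          m S [ x ] ↭-refl (+-comm m 1)

  -- Counting by sums, Cauchy-Schwarz, averaging, and lists without repetition.

  length-filter-∑ : ∀ {P : Pred A 0ℓ} (P? : U.Decidable P) xs → length (filter P? xs) ≡ ∑ xs (𝟙 ∘ P?)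
  length-filter-∑ P? []       = refl
  length-filter-∑ P? (x ∷ xs) with P? x
  ... | yes _ = cong suc (length-filter-∑ P? xs)
  ... | no  _ = length-filter-∑ P? xs

  ∑-cartesianProduct : ∀ (xs : List A) (ys : List B) f →
                       ∑ (cartesianProduct xs ys) f ≡ ∑ xs (λ x → ∑ ys (λ y → f (x , y)))
  ∑-cartesianProduct []       ys f = refl
  ∑-cartesianProduct (x ∷ xs) ys f = ≡.trans (∑-++ (map (x ,_) ys) _ f)
    (cong₂ _+_ (cong sum (≡.sym (map-∘ ys))) (∑-cartesianProduct xs ys f))

  2xy≤x²+y² : ∀ x y → 2 * (x * y) ≤ x * x + y * y
  2xy≤x²+y² x y with ≤-total x y
  ... | inj₁ x≤y with m≤n⇒∃[o]m+o≡n x≤y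
  ...   | z , refl = m+n≤o⇒m≤o _ (≤-reflexive (expand x z))
    where
    expand : ∀ x z → 2 * (x * (x + z)) + z * z ≡ x * x + (x + z) * (x + z)
    expand = solve-∀
  2xy≤x²+y² x y | inj₂ y≤x with m≤n⇒∃[o]m+o≡n y≤x
  ...   | z , refl = m+n≤o⇒m≤o _ (≤-reflexive (expand y z))
    where
    expand : ∀ y z → 2 * ((y + z) * y) + z * z ≡ (y + z) * (y + z) + y * y
    expand = solve-∀

  -- Induction on the list: the cross term of the square is a sum of products `2 * (f x * f y)`,
  -- each at most the sum of the two squares.
  cauchy-schwarz : ∀ (xs : List A) f → ∑ xs f * ∑ xs f ≤ length xs * ∑ xs (λ x → f x * f x)
  cauchy-schwarz []       f = z≤n
  cauchy-schwarz (x ∷ xs) f = begin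
    (f x + s) * (f x + s)
      ≡⟨ expand (f x) s ⟩
    f x * f x + 2 * (f x * s) + s * s
      ≤⟨ +-mono-≤ (+-monoʳ-≤ (f x * f x) cross) (cauchy-schwarz xs f) ⟩
    f x * f x + (length xs * (f x * f x) + q) + length xs * q
      ≡⟨ collect (f x * f x) q (length xs) ⟩
    suc (length xs) * (f x * f x + q) ∎
    where
    open ≤-Reasoning
    s = ∑ xs f
    q = ∑ xs (λ y → f y * f y)
    expand : ∀ u s → (u + s) * (u + s) ≡ u * u + 2 * (u * s) + s * s
    expand = solve-∀
    collect : ∀ u q l → u + (l * u + q) + l * q ≡ suc l * (u + q)
    collect = solve-∀
    cross : 2 * (f x * s) ≤ length xs * (f x * f x) + q
    cross = begin
      2 * (f x * s)                            ≡⟨ cong (2 *_) (∑-distrib-* xs (f x) f) ⟨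
      2 * ∑ xs (λ y → f x * f y)               ≡⟨ ∑-distrib-* xs 2 (λ y → f x * f y) ⟨
      ∑ xs (λ y → 2 * (f x * f y))             ≤⟨ ∑-mono-≤ xs (λ y → 2xy≤x²+y² (f x) (f y)) ⟩
      ∑ xs (λ y → f x * f x + f y * f y)       ≡⟨ ∑-distrib-+ xs (λ _ → f x * f x) (λ y → f y * f y) ⟩
      ∑ xs (λ _ → f x * f x) + q               ≡⟨ cong (_+ q) (∑-const xs (f x * f x)) ⟩
      length xs * (f x * f x) + q              ∎

  -- The witness is an entry of the list at which `f` is least.
  ∃-≤-average : ∀ (x : A) xs f → ∃[ y ] length (x ∷ xs) * f y ≤ ∑ (x ∷ xs) f
  ∃-≤-average x []        f = x , ≤-refl
  ∃-≤-average x (x′ ∷ xs) f with ∃-≤-average x′ xs f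
  ... | y , avg with ≤-total (f x) (f y)
  ...   | inj₁ fx≤fy = x , +-monoʳ-≤ (f x) (≤-trans (*-monoʳ-≤ (suc (length xs)) fx≤fy) avg)
  ...   | inj₂ fy≤fx = y , +-mono-≤ fy≤fx avg

  Unique-++⁻ˡ : ∀ xs {ys : List A} → Unique (xs ++ ys) → Unique xs
  Unique-++⁻ˡ []       _             = []
  Unique-++⁻ˡ (x ∷ xs) (x∉ ∷ unique) = Allₚ.++⁻ˡ xs x∉ ∷ Unique-++⁻ˡ xs unique

  Unique-resp-↭ : ∀ {xs ys : List A} → xs ↭ ys → Unique xs → Unique ys
  Unique-resp-↭ p = ↭ₛ.Unique-resp-↭ (≡.setoid _) (↭⇒↭ₛ p)

  lookup-injective : ∀ {xs : List A} → Unique xs → ∀ {i j} → lookup xs i ≡ lookup xs j → i ≡ j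
  lookup-injective (_ ∷ _)  {Fin.zero}  {Fin.zero}  _  = refl
  lookup-injective (x∉ ∷ _) {Fin.zero}  {Fin.suc j} eq = contradiction eq (All.lookup x∉ (∈-lookup j))
  lookup-injective (x∉ ∷ _) {Fin.suc i} {Fin.zero}  eq = contradiction (≡.sym eq) (All.lookup x∉ (∈-lookup i))
  lookup-injective (_ ∷ u)  {Fin.suc i} {Fin.suc j} eq = cong Fin.suc (lookup-injective u eq)

  -- Degrees, neighbourhoods and the cut around a neighbourhood.

  module _ {n : ℕ} where

    private
      V : List (Fin n)
      V = allFin n

    module EG (H : Graph n) = ErdősGallai (Graph.adj? H) (Graph.sym H) (Graph.irrefl H)

    degree : Graph n → Fin n → ℕ
    degree H v = EG.deg H v V

    -- An adjacent pair is seen once in each orientation, while `edges` lists only the increasing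
    -- one; `u` is the indicator of being listed.
    handshake : ∀ H → ∑ V (degree H) ≡ 2 * e H
    handshake H = begin
      ∑ V (λ i → ∑ V (λ j → EG.a H i j))           ≡⟨ ∑-cong V (λ i → ∑-cong V (orient i)) ⟩
      ∑ V (λ i → ∑ V (λ j → u i j + u j i))        ≡⟨ ∑-cong V (λ i → ∑-distrib-+ V (u i) (λ j → u j i)) ⟩
      ∑ V (λ i → ∑ V (u i) + ∑ V (λ j → u j i))    ≡⟨ ∑-distrib-+ V (λ i → ∑ V (u i)) (λ i → ∑ V (λ j → u j i)) ⟩
      U + ∑ V (λ i → ∑ V (λ j → u j i))            ≡⟨ cong (U +_) (∑-swap V V (λ i j → u j i)) ⟩
      U + U                                        ≡⟨ cong (U +_) (+-identityʳ U) ⟨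
      2 * U                                        ≡⟨ cong (2 *_) (∑-cartesianProduct V V (λ (i , j) → u i j)) ⟨
      2 * ∑ (cartesianProduct V V) (λ (i , j) → u i j)
        ≡⟨ cong (2 *_) (length-filter-∑ (λ (i , j) → (i Finₚ.<? j) ×-dec Graph.adj? H i j) (cartesianProduct V V)) ⟨
      2 * e H                                      ∎
      where
      open ≡.≡-Reasoning
      u : Fin n → Fin n → ℕ
      u i j = 𝟙 ((i Finₚ.<? j) ×-dec Graph.adj? H i j)
      U = ∑ V (λ i → ∑ V (u i))
      below : ∀ {i j} → i Fin.< j → EG.a H i j ≡ u i j
      below {i} {j} i<j = 𝟙-cong (Graph.adj? H i j) ((i Finₚ.<? j) ×-dec Graph.adj? H i j) (i<j ,_) proj₂
      notbelow : ∀ {i j} → ¬ i Fin.< j → u i j ≡ 0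
      notbelow {i} {j} i≮j = 𝟙-false ((i Finₚ.<? j) ×-dec Graph.adj? H i j) (i≮j ∘ proj₁)
      orient : ∀ i j → EG.a H i j ≡ u i j + u j i
      orient i j with Finₚ.<-cmp i j
      ... | tri< i<j _ j≮i = ≡.trans (below i<j) (≡.sym (≡.trans (cong (u i j +_) (notbelow j≮i)) (+-identityʳ (u i j))))
      ... | tri≈ i≮i refl _ = ≡.trans (EG.a-diag H i) (≡.sym (cong₂ _+_ (notbelow i≮i) (notbelow i≮i)))
      ... | tri> i≮j _ j<i = ≡.trans (EG.a-sym H i j) (≡.trans (below {j} {i} j<i) (cong (_+ u j i) (≡.sym (notbelow {i} {j} i≮j))))

    module _ (G : Graph n) where
      open Graph G
      open EG G

      lookup-consecutive : ∀ {x Xs y} → Path x Xs y → ∀ i j → suc (toℕ i) ≡ toℕ j →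
                           Adj (lookup Xs i) (lookup Xs j)
      lookup-consecutive [ x ]           Fin.zero    Fin.zero               ()
      lookup-consecutive (xy ∷ [ y ])    Fin.zero    (Fin.suc Fin.zero)     _  = xy
      lookup-consecutive (xy ∷ (_ ∷ _))  Fin.zero    (Fin.suc Fin.zero)     _  = xy
      lookup-consecutive (_ ∷ p)         (Fin.suc i) (Fin.suc j)            eq = lookup-consecutive p i j (suc-injective eq)

      start∈ : ∀ {x Xs y} → Path x Xs y → x ∈ Xs
      start∈ [ x ]   = here refl
      start∈ (_ ∷ _) = here refl

      -- The apex `v` is put at position 0. Steps forward are then path edges or the edge from `v`
      -- to the start, and the wrap-around step returns to `v`, which is adjacent to every vertex of
      -- the path.
      fan⇒cycle : ∀ {v x Xs y} → Path x Xs y → All (Adj v) Xs → Unique Xs →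
                  Contains (cycle (suc (length Xs))) G
      fan⇒cycle {v} {x} {Xs} p v~ unique =
        lookup (v ∷ Xs) , lookup-injective (All.map (λ v~w v≡w → irrefl (subst (Adj v) (≡.sym v≡w) v~w)) v~ ∷ unique) ,
        λ { (i≢j , inj₁ i→j) → cyclic i≢j i→j ; (i≢j , inj₂ j→i) → sym (cyclic (i≢j ∘ ≡.sym) j→i) }
        where
        cyclic : ∀ {i j} → i ≢ j → CyclicSuc i j → Adj (lookup (v ∷ Xs) i) (lookup (v ∷ Xs) j)
        cyclic {i} {j} _ (inj₁ consecutive) =
          lookup-consecutive (All.lookup v~ (start∈ p) ∷ p) i j consecutive
        cyclic {Fin.zero}  {Fin.zero} i≢j (inj₂ _) = contradiction refl i≢j
        cyclic {Fin.suc i} {Fin.zero} _   (inj₂ _) = sym (All.lookup v~ (∈-lookup i))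

      N : Fin n → List (Fin n)
      N v = filter (adj? v) V

      length-N : ∀ v → length (N v) ≡ degree G v
      length-N v = length-filter-∑ (adj? v) V

      -- A path on `suc m` vertices of `N v` inherits distinctness and adjacency to `v` along the
      -- permutation, so with `v` it would form the forbidden cycle.
      e₂-N≤ : ∀ m → Free (cycle (suc (suc m))) G → ∀ v → e₂ (N v) (N v) ≤ suc m * degree G v
      e₂-N≤ m free v = subst (λ l → e₂ (N v) (N v) ≤ suc m * l) (length-N v)
        (erdős-gallai m (N v) λ {_} {_} {Xs} N↭ p len → free (subst (λ l → Contains (cycle (suc l)) G) len
          (fan⇒cycle p (Allₚ.++⁻ˡ Xs (↭.All-resp-↭ N↭ (Allₚ.all-filter (adj? v) V)))
                       (Unique-++⁻ˡ Xs (Unique-resp-↭ N↭ (Uniqueₚ.filter⁺ (adj? v) (Uniqueₚ.allFin⁺ n)))))))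

      side : Fin n → Fin n → Bool
      side v i = does (adj? v i)

      -- The graph to be deleted; `e (uncut v)` is the quantity D(v).
      uncut : Fin n → Graph n
      uncut v = record
        { Adj    = λ i j → Adj i j × side v i ≡ side v j
        ; adj?   = λ i j → adj? i j ×-dec (side v i Boolₚ.≟ side v j)
        ; sym    = λ (ij , eq) → sym ij , ≡.sym eq
        ; irrefl = irrefl ∘ proj₁
        }

      uncut-bipartite : ∀ v → Bipartite (G ∖ uncut v)
      uncut-bipartite v = side v , λ (ij , cut) eq → cut (ij , eq)

      -- With p, q the indicators of i, j ∈ N v this is [p = q] + p + q = 1 + 2pq.
      uncut-local : ∀ v i j → EG.a (uncut v) i j + (a v i * a i j + a v j * a i j)
                              ≡ a i j + 2 * (a v i * (a v j * a i j))
      uncut-local v i j with adj? i j | adj? v i | adj? v j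
      ... | yes _ | yes _ | yes _ = refl
      ... | yes _ | yes _ | no  _ = refl
      ... | yes _ | no  _ | yes _ = refl
      ... | yes _ | no  _ | no  _ = refl
      ... | no  _ | yes _ | yes _ = refl
      ... | no  _ | yes _ | no  _ = refl
      ... | no  _ | no  _ | yes _ = refl
      ... | no  _ | no  _ | no  _ = refl

      neighbourDegrees : Fin n → ℕ
      neighbourDegrees v = ∑ V (λ i → a v i * degree G i)

      e₂-N : ∀ v → e₂ (N v) (N v) ≡ ∑ V (λ i → ∑ V (λ j → a v i * (a v j * a i j)))
      e₂-N v = begin
        ∑ (N v) (λ i → ∑ (N v) (a i))                        ≡⟨ ∑-filter (adj? v) V _ ⟩
        ∑ V (λ i → a v i * ∑ (N v) (a i))                    ≡⟨ ∑-cong V (λ i → cong (a v i *_) (∑-filter (adj? v) V (a i))) ⟩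
        ∑ V (λ i → a v i * ∑ V (λ j → a v j * a i j))        ≡⟨ ∑-cong V (λ i → ∑-distrib-* V (a v i) (λ j → a v j * a i j)) ⟨
        ∑ V (λ i → ∑ V (λ j → a v i * (a v j * a i j)))      ∎
        where open ≡.≡-Reasoning

      ∑∑-distrib-+ : ∀ (f g : Fin n → Fin n → ℕ) →
        ∑ V (λ i → ∑ V (λ j → f i j + g i j)) ≡ ∑ V (λ i → ∑ V (f i)) + ∑ V (λ i → ∑ V (g i))
      ∑∑-distrib-+ f g = ≡.trans (∑-cong V (λ i → ∑-distrib-+ V (f i) (g i)))
        (∑-distrib-+ V (λ i → ∑ V (f i)) (λ i → ∑ V (g i)))

      -- `uncut-local` summed over all ordered pairs, which is why everything appears doubled. By
      -- symmetry of adjacency both mixed terms give `neighbourDegrees v`.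
      uncut-global : ∀ v → 2 * e (uncut v) + (neighbourDegrees v + neighbourDegrees v) ≡ 2 * e G + 2 * e₂ (N v) (N v)
      uncut-global v = begin
        2 * e (uncut v) + (neighbourDegrees v + neighbourDegrees v)
          ≡⟨ cong₂ _+_ (≡.sym (handshake (uncut v))) (cong₂ _+_ (≡.sym first) (≡.sym second)) ⟩
        ∑∑ (EG.a (uncut v)) + (∑∑ (λ i j → a v i * a i j) + ∑∑ (λ i j → a v j * a i j))
          ≡⟨ cong (∑∑ (EG.a (uncut v)) +_) (∑∑-distrib-+ _ _) ⟨
        ∑∑ (EG.a (uncut v)) + ∑∑ (λ i j → a v i * a i j + a v j * a i j)
          ≡⟨ ∑∑-distrib-+ _ _ ⟨
        ∑∑ (λ i j → EG.a (uncut v) i j + (a v i * a i j + a v j * a i j))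
          ≡⟨ ∑-cong V (λ i → ∑-cong V (uncut-local v i)) ⟩
        ∑∑ (λ i j → a i j + 2 * (a v i * (a v j * a i j)))
          ≡⟨ ∑∑-distrib-+ a _ ⟩
        ∑∑ a + ∑∑ (λ i j → 2 * (a v i * (a v j * a i j)))
          ≡⟨ cong₂ _+_ (handshake G) (≡.trans (∑-cong V (λ i → ∑-distrib-* V 2 _)) (≡.trans (∑-distrib-* V 2 _) (cong (2 *_) (≡.sym (e₂-N v))))) ⟩
        2 * e G + 2 * e₂ (N v) (N v) ∎
        where
        open ≡.≡-Reasoning
        ∑∑ : (Fin n → Fin n → ℕ) → ℕ
        ∑∑ f = ∑ V (λ i → ∑ V (f i))
        first : ∑∑ (λ i j → a v i * a i j) ≡ neighbourDegrees v
        first = ∑-cong V (λ i → ∑-distrib-* V (a v i) (a i))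
        second : ∑∑ (λ i j → a v j * a i j) ≡ neighbourDegrees v
        second = ≡.trans (∑-swap V V (λ i j → a v j * a i j))
          (≡.trans (∑-cong V (λ j → ∑-cong V (λ i → cong (a v j *_) (a-sym i j)))) first)

      -- Double counting: the degree of `i` is counted once for each neighbour `v` of `i`.
      ∑-neighbourDegrees : ∑ V neighbourDegrees ≡ ∑ V (λ i → degree G i * degree G i)
      ∑-neighbourDegrees = ≡.trans (∑-swap V V (λ v i → a v i * degree G i)) (∑-cong V λ i → begin
        ∑ V (λ v → a v i * degree G i)    ≡⟨ ∑-cong V (λ v → ≡.trans (*-comm (a v i) _) (cong (degree G i *_) (a-sym v i))) ⟩
        ∑ V (λ v → degree G i * a i v)    ≡⟨ ∑-distrib-* V (degree G i) (a i) ⟩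
        degree G i * degree G i           ∎)
        where open ≡.≡-Reasoning

      length-V : length V ≡ n
      length-V = length-tabulate id

      -- Since `e₂` counts edges twice, the hypothesis reads e(G[N(v)]) ≤ k d(v).
      module _ (k : ℕ) (e₂-N≤2kd : ∀ v → e₂ (N v) (N v) ≤ 2 * k * degree G v) where

        uncut≤ : ∀ v → e (uncut v) + neighbourDegrees v ≤ e G + 2 * k * degree G v
        uncut≤ v = *-cancelˡ-≤ 2 (begin
          2 * (e (uncut v) + neighbourDegrees v)
            ≡⟨ eq₁ (e (uncut v)) (neighbourDegrees v) ⟩
          2 * e (uncut v) + (neighbourDegrees v + neighbourDegrees v)
            ≡⟨ uncut-global v ⟩
          2 * e G + 2 * e₂ (N v) (N v)         ≡⟨ *-distribˡ-+ 2 (e G) _ ⟨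
          2 * (e G + e₂ (N v) (N v))           ≤⟨ *-monoʳ-≤ 2 (+-monoʳ-≤ (e G) (e₂-N≤2kd v)) ⟩
          2 * (e G + 2 * k * degree G v)       ∎)
          where
          open ≤-Reasoning
          eq₁ : ∀ x y → 2 * (x + y) ≡ 2 * x + (y + y)
          eq₁ = solve-∀

        ∑-uncut≤ : ∑ V (e ∘ uncut) + ∑ V (λ i → degree G i * degree G i) ≤ n * e G + 4 * k * e G
        ∑-uncut≤ = begin
          ∑ V (e ∘ uncut) + ∑ V (λ i → degree G i * degree G i)   ≡⟨ cong (∑ V (e ∘ uncut) +_) ∑-neighbourDegrees ⟨
          ∑ V (e ∘ uncut) + ∑ V neighbourDegrees                  ≡⟨ ∑-distrib-+ V (e ∘ uncut) neighbourDegrees ⟨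
          ∑ V (λ v → e (uncut v) + neighbourDegrees v)            ≤⟨ ∑-mono-≤ V uncut≤ ⟩
          ∑ V (λ v → e G + 2 * k * degree G v)                    ≡⟨ ∑-distrib-+ V (λ _ → e G) (λ v → 2 * k * degree G v) ⟩
          ∑ V (λ _ → e G) + ∑ V (λ v → 2 * k * degree G v)
            ≡⟨ cong₂ _+_ (≡.trans (∑-const V (e G)) (cong (_* e G) length-V)) (∑-distrib-* V (2 * k) (degree G)) ⟩
          n * e G + 2 * k * ∑ V (degree G)                        ≡⟨ cong (λ i → n * e G + 2 * k * i) (handshake G) ⟩
          n * e G + 2 * k * (2 * e G)                             ≡⟨ eq₂ n k (e G) ⟩
          n * e G + 4 * k * e G                                   ∎
          where
          open ≤-Reasoning
          eq₂ : ∀ n k x → n * x + 2 * k * (2 * x) ≡ n * x + 4 * k * x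
          eq₂ = solve-∀

        4e²≤ : 4 * (e G * e G) ≤ n * ∑ V (λ i → degree G i * degree G i)
        4e²≤ = begin
          4 * (e G * e G)                    ≡⟨ eq₃ (e G) ⟩
          (2 * e G) * (2 * e G)              ≡⟨ cong₂ _*_ (handshake G) (handshake G) ⟨
          ∑ V (degree G) * ∑ V (degree G)    ≤⟨ cauchy-schwarz V (degree G) ⟩
          length V * _                       ≡⟨ cong (_* ∑ V (λ i → degree G i * degree G i)) length-V ⟩
          n * _                              ∎
          where
          open ≤-Reasoning
          eq₃ : ∀ x → 4 * (x * x) ≡ (2 * x) * (2 * x)
          eq₃ = solve-∀

        uncut-averaged : ∀ v → n * e (uncut v) ≤ ∑ V (e ∘ uncut) →
                         n * (n * e (uncut v)) + 4 * (e G * e G) ≤ n * (n * e G + 4 * k * e G)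
        uncut-averaged v avg = begin
          n * (n * e (uncut v)) + 4 * (e G * e G)                          ≤⟨ +-mono-≤ (*-monoʳ-≤ n avg) 4e²≤ ⟩
          n * ∑ V (e ∘ uncut) + n * ∑ V (λ i → degree G i * degree G i)    ≡⟨ *-distribˡ-+ n (∑ V (e ∘ uncut)) _ ⟨
          n * (∑ V (e ∘ uncut) + ∑ V (λ i → degree G i * degree G i))      ≤⟨ *-monoʳ-≤ n ∑-uncut≤ ⟩
          n * (n * e G + 4 * k * e G)                                      ∎
          where open ≤-Reasoning

  -- The chosen `v` minimises `e (uncut G v)`; writing the order as `suc n` provides a vertex to
  -- start the minimum from.
  ∃-uncut≤ : ∀ {n} (G : Graph (suc n)) k → (∀ v → EG.e₂ G (N G v) (N G v) ≤ 2 * k * degree G v) →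
    ∃[ v ] suc n * (suc n * e (uncut G v)) + 4 * (e G * e G) ≤ suc n * (suc n * e G + 4 * k * e G)
  ∃-uncut≤ {n} G k bound with ∃-≤-average (Fin.zero {n}) (tabulate Fin.suc) (e ∘ uncut G)
  ... | v , avg = v , uncut-averaged G k bound v
    (≤-trans (≤-reflexive (cong (_* e (uncut G v)) (≡.sym (length-V G)))) avg)

  -- The square is that of n² - 4E, used as 2 · n² · 4E ≤ n⁴ + (4E)². To stay within the naturals,
  -- the conclusion is multiplied by `n` and `c` is added to both sides in place of subtracting
  -- terms; both are cancelled at the start.
  completed-square : ∀ {n D E} k r .{{_ : ℕ.NonZero n}} → n ≡ 4 * k + r →
    n * (n * D) + 4 * (E * E) ≤ n * (n * E + 4 * k * E) →
    4 * (n * D) + 4 * (r * E) ≤ n * (n * n)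
  completed-square {n} {D} {E} k r n≡4k+r le = *-cancelˡ-≤ n (+-cancelʳ-≤ c _ _ (begin
    n * (4 * (n * D) + 4 * (r * E)) + c                              ≡⟨ eq₁ n D E k r ⟩
    4 * (n * (n * D) + 4 * (E * E)) + 4 * (n * (r + 4 * k) * E)      ≡⟨ cong (λ i → 4 * (n * (n * D) + 4 * (E * E)) + 4 * (n * i * E)) r+4k≡n ⟩
    4 * (n * (n * D) + 4 * (E * E)) + 4 * (n * n * E)                ≤⟨ +-monoˡ-≤ _ (*-monoʳ-≤ 4 le) ⟩
    4 * (n * (n * E + 4 * k * E)) + 4 * (n * n * E)                  ≡⟨ eq₂ n E k ⟩
    2 * ((n * n) * (4 * E)) + 16 * (n * k * E)                       ≤⟨ +-monoˡ-≤ _ (2xy≤x²+y² (n * n) (4 * E)) ⟩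
    ((n * n) * (n * n) + (4 * E) * (4 * E)) + 16 * (n * k * E)       ≡⟨ eq₃ n E k ⟩
    n * (n * (n * n)) + c                                            ∎))
    where
    open ≤-Reasoning
    c = 16 * (E * E) + 16 * (n * k * E)
    r+4k≡n : r + 4 * k ≡ n
    r+4k≡n = ≡.trans (+-comm r (4 * k)) (≡.sym n≡4k+r)
    eq₁ : ∀ n D E k r → n * (4 * (n * D) + 4 * (r * E)) + (16 * (E * E) + 16 * (n * k * E))
                        ≡ 4 * (n * (n * D) + 4 * (E * E)) + 4 * (n * (r + 4 * k) * E)
    eq₁ = solve-∀
    eq₂ : ∀ n E k → 4 * (n * (n * E + 4 * k * E)) + 4 * (n * n * E)
                    ≡ 2 * ((n * n) * (4 * E)) + 16 * (n * k * E)
    eq₂ = solve-∀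
    eq₃ : ∀ n E k → ((n * n) * (n * n) + (4 * E) * (4 * E)) + 16 * (n * k * E)
                    ≡ n * (n * (n * n)) + (16 * (E * E) + 16 * (n * k * E))
    eq₃ = solve-∀

-- Order, reciprocals and natural multiples in an ordered field with apartness.

module OrderedFieldProperties {c ℓ₁ ℓ₂ ℓ₃ : Level} (K : OrderedField c ℓ₁ ℓ₂ ℓ₃) where
  open import Algebra.Bundles using (CommutativeRing)
  import Algebra.Apartness.Properties.HeytingCommutativeRing as HeytingProps
  import Algebra.Properties.Semiring.Mult as SemiringMult
  import Algebra.Solver.Ring.NaturalCoefficients.Default as SemiringSolver
  import Relation.Binary.Reasoning.Base.Triple as Triple
  open import Relation.Binary.Structures using (IsPreorder)
  open OrderedField K
  open CommutativeRing commutativeRing using (commutativeSemiring; semiring)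
  open SemiringMult semiring using (×-homo-+; ×1-homo-*)
  open HeytingProps heytingCommutativeRing using (x-0≈x)
  open SemiringSolver commutativeSemiring using (Polynomial; solve; _:=_; _:+_; _:*_; con)

  private variable
    x y z w : Carrier

  -- The constructive substitute for trichotomy. As `≤` is a negated `<`, its transitivity and the
  -- mixed laws all rest on this comparison.
  <-cotrans : x < y → ∀ z → x < z ⊎ z < y
  <-cotrans x<y z with #-cotrans (<⇒# x<y) z
  ... | inj₁ x#z with #⇒<⊎> x#z
  ...   | inj₁ x<z = inj₁ x<z
  ...   | inj₂ z<x = inj₂ (<-trans z<x x<y)
  <-cotrans x<y z | inj₂ z#y with #⇒<⊎> z#y
  ...   | inj₁ z<y = inj₂ z<y
  ...   | inj₂ y<z = inj₁ (<-trans x<y y<z)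

  <-respˡ : x ≈ y → x < z → y < z
  <-respˡ = proj₂ <-resp-≈

  <-respʳ : x ≈ y → z < x → z < y
  <-respʳ = proj₁ <-resp-≈

  <-asym : x < y → ¬ y < x
  <-asym x<y y<x = <-irrefl refl (<-trans x<y y<x)

  ≤-trans : x ≤ y → y ≤ z → x ≤ z
  ≤-trans {y = y} x≤y y≤z z<x with <-cotrans z<x y
  ... | inj₁ z<y = y≤z z<y
  ... | inj₂ y<x = x≤y y<x

  <-≤-trans : x < y → y ≤ z → x < z
  <-≤-trans {z = z} x<y y≤z with <-cotrans x<y z
  ... | inj₁ x<z = x<z
  ... | inj₂ z<y = contradiction z<y y≤z

  ≤-<-trans : x ≤ y → y < z → x < z
  ≤-<-trans {x} x≤y y<z with <-cotrans y<z x
  ... | inj₁ y<x = contradiction y<x x≤y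
  ... | inj₂ x<z = x<z

  ≤-isPreorder : IsPreorder _≈_ _≤_
  ≤-isPreorder = record
    { isEquivalence = isEquivalence
    ; reflexive     = λ x≈y y<x → <-irrefl (sym x≈y) y<x
    ; trans         = ≤-trans
    }

  module ≤-Reasoning = Triple ≤-isPreorder <-asym <-trans <-resp-≈ <-asym <-≤-trans ≤-<-trans

  +-monoʳ-< : ∀ z → x < y → z + x < z + y
  +-monoʳ-< z x<y = <-respˡ (+-comm _ z) (<-respʳ (+-comm _ z) (+-monoˡ-< z x<y))

  +-cancelʳ-< : ∀ z → x + z < y + z → x < y
  +-cancelʳ-< z lt = <-respˡ (cancel _) (<-respʳ (cancel _) (+-monoˡ-< (- z) lt))
    where
    cancel : ∀ u → (u + z) + - z ≈ u
    cancel u = trans (+-assoc u z (- z)) (trans (+-congˡ (-‿inverseʳ z)) (+-identityʳ u))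

  +-monoˡ-≤ : ∀ z → x ≤ y → x + z ≤ y + z
  +-monoˡ-≤ z x≤y = x≤y ∘ +-cancelʳ-< z

  +-monoʳ-≤ : ∀ z → x ≤ y → z + x ≤ z + y
  +-monoʳ-≤ z x≤y lt = +-monoˡ-≤ z x≤y (<-respˡ (+-comm z _) (<-respʳ (+-comm z _) lt))

  +-mono-≤ : x ≤ y → z ≤ w → x + z ≤ y + w
  +-mono-≤ x≤y z≤w = ≤-trans (+-monoˡ-≤ _ x≤y) (+-monoʳ-≤ _ z≤w)

  *-monoʳ-< : 0# < z → x < y → z * x < z * y
  *-monoʳ-< {z} {x} {y} 0<z x<y = <-respˡ (+-identityˡ (z * x)) (<-respʳ eq (+-monoˡ-< (z * x) (*-pos 0<z 0<y-x)))
    where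
    0<y-x : 0# < y + - x
    0<y-x = <-respˡ (-‿inverseʳ x) (+-monoˡ-< (- x) x<y)
    eq : z * (y + - x) + z * x ≈ z * y
    eq = trans (sym (distribˡ z _ x)) (*-congˡ
      (trans (+-assoc y (- x) x) (trans (+-congˡ (-‿inverseˡ x)) (+-identityʳ y))))

  -- An invertible element is apart from 0, hence positive or negative; a negative reciprocal would
  -- give 1 < 0.
  recip-pos : ∀ x (0<x : 0# < x) → 0# < recip x 0<x
  recip-pos x 0<x with #⇒<⊎> r#0
    where
    r = recip x 0<x
    r#0 : r # 0#
    r#0 = invertible⇒# (x ,
      trans (*-congˡ (x-0≈x r)) (recip-inverse x 0<x) ,
      trans (*-congʳ (x-0≈x r)) (trans (*-comm r x) (recip-inverse x 0<x)))
  ... | inj₂ 0<r = 0<r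
  ... | inj₁ r<0 = contradiction
    (<-respˡ (recip-inverse x 0<x) (<-respʳ (zeroʳ x) (*-monoʳ-< 0<x r<0))) (<-asym 0<1)

  *-monoˡ-≤ : 0# < z → x ≤ y → x * z ≤ y * z
  *-monoˡ-≤ {z} 0<z x≤y lt = x≤y (<-respˡ (cancel _) (<-respʳ (cancel _) (*-monoʳ-< (recip-pos z 0<z) lt)))
    where
    r = recip z 0<z
    cancel : ∀ u → r * (u * z) ≈ u
    cancel u = trans (solve 3 (λ r u z → r :* (u :* z) := u :* (z :* r)) refl r u z)
      (trans (*-congˡ (recip-inverse z 0<z)) (*-identityʳ u))

  fromℕ-+ : ∀ m n → fromℕ (m ℕ.+ n) ≈ fromℕ m + fromℕ n
  fromℕ-+ = ×-homo-+ 1#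

  fromℕ-* : ∀ m n → fromℕ (m ℕ.* n) ≈ fromℕ m * fromℕ n
  fromℕ-* = ×1-homo-*

  0≤fromℕ : ∀ m → 0# ≤ fromℕ m
  0≤fromℕ zero    = <-irrefl refl
  0≤fromℕ (suc m) = <-asym (0<fromℕ-suc m)

  fromℕ-mono-≤ : ∀ {m n} → m ℕ.≤ n → fromℕ m ≤ fromℕ n
  fromℕ-mono-≤ {m} m≤n with m≤n⇒∃[o]m+o≡n m≤n
  ... | o , ≡.refl = begin
    fromℕ m             ≈⟨ +-identityʳ _ ⟨
    fromℕ m + 0#        ≤⟨ +-monoʳ-≤ (fromℕ m) (0≤fromℕ o) ⟩
    fromℕ m + fromℕ o   ≈⟨ fromℕ-+ m o ⟨
    fromℕ (m ℕ.+ o)     ∎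
    where open ≤-Reasoning

  fromℕ-mono-< : ∀ {m n} → m ℕ.< n → fromℕ m < fromℕ n
  fromℕ-mono-< {m} {n} m<n = begin-strict
    fromℕ m         ≈⟨ +-identityˡ _ ⟨
    0# + fromℕ m    <⟨ +-monoˡ-< (fromℕ m) 0<1 ⟩
    1# + fromℕ m    ≤⟨ fromℕ-mono-≤ m<n ⟩
    fromℕ n         ∎
    where open ≤-Reasoning

  -- Proved by repeated addition instead of cancelling a positive factor, so that `m` may be zero.
  fromℕ-*-mono-≤ : ∀ m → x ≤ y → fromℕ m * x ≤ fromℕ m * y
  fromℕ-*-mono-≤ {x} {y} zero    x≤y = <-irrefl (trans (zeroˡ y) (sym (zeroˡ x)))
  fromℕ-*-mono-≤ {x} {y} (suc m) x≤y = begin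
    fromℕ (suc m) * x       ≈⟨ unfold x ⟩
    x + fromℕ m * x         ≤⟨ +-mono-≤ x≤y (fromℕ-*-mono-≤ m x≤y) ⟩
    y + fromℕ m * y         ≈⟨ unfold y ⟨
    fromℕ (suc m) * y       ∎
    where
    open ≤-Reasoning
    unfold : ∀ u → fromℕ (suc m) * u ≈ u + fromℕ m * u
    unfold u = trans (distribʳ u 1# (fromℕ m)) (+-congʳ (*-identityˡ u))

  m*[x/ℕm]≈x : ∀ m x → fromℕ (suc m) * (x /ℕ suc m) ≈ x
  m*[x/ℕm]≈x m x =
    trans (solve 3 (λ m x r → m :* (x :* r) := x :* (m :* r)) refl (fromℕ (suc m)) x _)
      (trans (*-congˡ (recip-inverse _ (0<fromℕ-suc m))) (*-identityʳ x))

  -- Unlike con m, this polynomial evaluates to fromℕ m definitionally.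
  num : ∀ {v} → ℕ → Polynomial v
  num zero    = con 0
  num (suc m) = con 1 :+ num m

  -- From the counting inequality to the bound with ε.

  module Threshold {ε : Carrier} (0<ε : 0# < ε) (n : ℕ) where

    private
      ν N : Carrier
      ν = fromℕ n
      N = ν * ν

    open ≤-Reasoning

    m≤εn : ∀ m → fromℕ m ÷ ε [ 0<ε ] ≤ ν → fromℕ m ≤ ε * ν
    m≤εn m n₀≤n εn<m = n₀≤n (<-respˡ eq (<-respʳ (*-comm r (fromℕ m)) (*-monoʳ-< (recip-pos ε 0<ε) εn<m)))
      where
      r = recip ε 0<ε
      eq : r * (ε * ν) ≈ ν
      eq = trans (sym (*-assoc r ε ν)) (trans (*-congʳ (trans (*-comm r ε) (recip-inverse ε 0<ε))) (*-identityˡ ν))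

    -- In the field 4k = 2 · 2k ≤ 2εn ≤ n. The order on naturals is decidable, so refuting n < 4k is
    -- enough.
    4k≤n : ∀ k → ε < 1# /ℕ 2 → fromℕ (2 ℕ.* k) ≤ ε * ν → 4 ℕ.* k ℕ.≤ n
    4k≤n k ε<½ 2k≤εn = ≮⇒≥ λ n<4k → <-irrefl refl (begin-strict
      ν                               <⟨ fromℕ-mono-< n<4k ⟩
      fromℕ (4 ℕ.* k)                 ≡⟨ ≡.cong fromℕ (ℕₚ.*-assoc 2 2 k) ⟩
      fromℕ (2 ℕ.* (2 ℕ.* k))         ≈⟨ fromℕ-* 2 (2 ℕ.* k) ⟩
      fromℕ 2 * fromℕ (2 ℕ.* k)       ≤⟨ fromℕ-*-mono-≤ 2 2k≤εn ⟩
      fromℕ 2 * (ε * ν)               ≈⟨ solve 2 (λ ε ν → num 2 :* (ε :* ν) := ν :* (num 2 :* ε)) refl ε ν ⟩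
      ν * (fromℕ 2 * ε)               ≤⟨ fromℕ-*-mono-≤ n (fromℕ-*-mono-≤ 2 (<-asym ε<½)) ⟩
      ν * (fromℕ 2 * (1# /ℕ 2))       ≈⟨ *-congˡ (m*[x/ℕm]≈x 1 1#) ⟩
      ν * 1#                          ≈⟨ *-identityʳ ν ⟩
      ν                               ∎)

    -- Four times the density hypothesis, with 4δ = 2ε moved to the other side.
    n²≤4e+2εn² : ∀ {η} → (1# /ℕ 4 - ε /ℕ 2) * N ≤ η → N ≤ fromℕ 4 * η + fromℕ 2 * (ε * N)
    n²≤4e+2εn² {η} dense = begin
      N                                               ≈⟨ *-identityˡ N ⟨
      1# * N                                          ≈⟨ *-congʳ (m*[x/ℕm]≈x 3 1#) ⟨
      (fromℕ 4 * ¼) * N                               ≈⟨ *-congʳ (+-identityʳ _) ⟨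
      (fromℕ 4 * ¼ + 0#) * N                          ≈⟨ *-congʳ (+-congˡ (trans (*-congˡ (-‿inverseʳ δ)) (zeroʳ _))) ⟨
      (fromℕ 4 * ¼ + fromℕ 4 * (δ - δ)) * N
        ≈⟨ solve 4 (λ q d d⁻ N → (num 4 :* q :+ num 4 :* (d :+ d⁻)) :* N
                      := num 4 :* ((q :+ d⁻) :* N) :+ num 2 :* ((num 2 :* d) :* N)) refl ¼ δ (- δ) N ⟩
      fromℕ 4 * ((¼ - δ) * N) + fromℕ 2 * ((fromℕ 2 * δ) * N)
        ≈⟨ +-congˡ (*-congˡ (*-congʳ (m*[x/ℕm]≈x 1 ε))) ⟩
      fromℕ 4 * ((¼ - δ) * N) + fromℕ 2 * (ε * N)     ≤⟨ +-monoˡ-≤ _ (fromℕ-*-mono-≤ 4 dense) ⟩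
      fromℕ 4 * η + fromℕ 2 * (ε * N)                 ∎
      where
      ¼ δ : Carrier
      ¼ = 1# /ℕ 4
      δ = ε /ℕ 2

    -- If ε n² < D, then 4n times this, the counting inequality and `r` times the density bound
    -- chain up to a quantity strictly below itself.
    D≤εn² : ∀ {D E} k r .{{_ : ℕ.NonZero n}} → 4 ℕ.* k ℕ.+ r ≡ n →
            4 ℕ.* (n ℕ.* D) ℕ.+ 4 ℕ.* (r ℕ.* E) ℕ.≤ n ℕ.* (n ℕ.* n) →
            fromℕ (2 ℕ.* k) ≤ ε * ν →
            N ≤ fromℕ 4 * fromℕ E + fromℕ 2 * (ε * N) →
            fromℕ D ≤ ε * N
    D≤εn² {D} {E} k r {{n≢0}} 4k+r≡n counted 2k≤εn dense εn²<D = <-irrefl refl (begin-strict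
      fromℕ 4 * (ν * (ε * N)) + ρ * N
        <⟨ +-monoˡ-< (ρ * N) (*-monoʳ-< (0<fromℕ-suc 3) (*-monoʳ-< 0<ν εn²<D)) ⟩
      fromℕ 4 * (ν * fromℕ D) + ρ * N
        ≤⟨ +-monoʳ-≤ _ (fromℕ-*-mono-≤ r dense) ⟩
      fromℕ 4 * (ν * fromℕ D) + ρ * (fromℕ 4 * fromℕ E + fromℕ 2 * (ε * N))
        ≈⟨ solve 5 (λ x ρ η ε N → x :+ ρ :* (num 4 :* η :+ num 2 :* (ε :* N))
                      := (x :+ num 4 :* (ρ :* η)) :+ num 2 :* (ρ :* (ε :* N))) refl _ ρ (fromℕ E) ε N ⟩
      (fromℕ 4 * (ν * fromℕ D) + fromℕ 4 * (ρ * fromℕ E)) + fromℕ 2 * (ρ * (ε * N))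
        ≤⟨ +-monoˡ-≤ _ counted′ ⟩
      ν * N + fromℕ 2 * (ρ * (ε * N))
        ≈⟨ +-congʳ (trans (*-congʳ ν≈) (solve 3 (λ t ρ N → (num 2 :* t :+ ρ) :* N := ρ :* N :+ num 2 :* (N :* t)) refl τ ρ N)) ⟩
      (ρ * N + fromℕ 2 * (N * τ)) + fromℕ 2 * (ρ * (ε * N))
        -- Each of the two error terms is at most 2εn³, the first because 2k ≤ εn and the second
        -- because r ≤ n; together they make up the starting term 4εn³.
        ≤⟨ +-mono-≤ (+-monoʳ-≤ (ρ * N) (fromℕ-*-mono-≤ 2 N*-mono)) (fromℕ-*-mono-≤ 2 ρ≤ν) ⟩
      (ρ * N + fromℕ 2 * (N * (ε * ν))) + fromℕ 2 * (ν * (ε * N))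
        ≈⟨ solve 4 (λ x ν ε N → (x :+ num 2 :* (N :* (ε :* ν))) :+ num 2 :* (ν :* (ε :* N))
                      := num 4 :* (ν :* (ε :* N)) :+ x) refl (ρ * N) ν ε N ⟩
      fromℕ 4 * (ν * (ε * N)) + ρ * N ∎)
      where
      ρ τ : Carrier
      ρ = fromℕ r
      τ = fromℕ (2 ℕ.* k)

      0<ν : 0# < ν
      0<ν = fromℕ-mono-< (ℕ.>-nonZero⁻¹ n)

      ν≈ : ν ≈ fromℕ 2 * τ + ρ
      ν≈ = begin-equality
        ν                                ≡⟨ ≡.cong fromℕ 4k+r≡n ⟨
        fromℕ (4 ℕ.* k ℕ.+ r)            ≈⟨ fromℕ-+ (4 ℕ.* k) r ⟩
        fromℕ (4 ℕ.* k) + ρ              ≡⟨ ≡.cong (λ m → fromℕ m + ρ) (ℕₚ.*-assoc 2 2 k) ⟩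
        fromℕ (2 ℕ.* (2 ℕ.* k)) + ρ      ≈⟨ +-congʳ (fromℕ-* 2 (2 ℕ.* k)) ⟩
        fromℕ 2 * τ + ρ                  ∎

      counted′ : fromℕ 4 * (ν * fromℕ D) + fromℕ 4 * (ρ * fromℕ E) ≤ ν * N
      counted′ = begin
        fromℕ 4 * (ν * fromℕ D) + fromℕ 4 * (ρ * fromℕ E)
          ≈⟨ +-cong (*-congˡ (fromℕ-* n D)) (*-congˡ (fromℕ-* r E)) ⟨
        fromℕ 4 * fromℕ (n ℕ.* D) + fromℕ 4 * fromℕ (r ℕ.* E)
          ≈⟨ +-cong (fromℕ-* 4 (n ℕ.* D)) (fromℕ-* 4 (r ℕ.* E)) ⟨
        fromℕ (4 ℕ.* (n ℕ.* D)) + fromℕ (4 ℕ.* (r ℕ.* E))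
          ≈⟨ fromℕ-+ (4 ℕ.* (n ℕ.* D)) (4 ℕ.* (r ℕ.* E)) ⟨
        fromℕ (4 ℕ.* (n ℕ.* D) ℕ.+ 4 ℕ.* (r ℕ.* E))
          ≤⟨ fromℕ-mono-≤ counted ⟩
        fromℕ (n ℕ.* (n ℕ.* n))
          ≈⟨ trans (fromℕ-* n (n ℕ.* n)) (*-congˡ (fromℕ-* n n)) ⟩
        ν * N ∎

      N*-mono : N * τ ≤ N * (ε * ν)
      N*-mono = begin
        N * τ               ≈⟨ *-assoc ν ν τ ⟩
        ν * (ν * τ)         ≤⟨ fromℕ-*-mono-≤ n (fromℕ-*-mono-≤ n 2k≤εn) ⟩
        ν * (ν * (ε * ν))   ≈⟨ *-assoc ν ν (ε * ν) ⟨
        N * (ε * ν)         ∎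

      ρ≤ν : ρ * (ε * N) ≤ ν * (ε * N)
      ρ≤ν = *-monoˡ-≤ (*-pos 0<ε (*-pos 0<ν 0<ν)) (fromℕ-mono-≤ (ℕₚ.m+n≤o⇒n≤o (4 ℕ.* k) (ℕₚ.≤-reflexive 4k+r≡n)))

-- Choice of the vertex and deletion of its uncut edges.

theorem4p8 :
  {c ℓ₁ ℓ₂ ℓ₃ : Level} (K : OrderedField c ℓ₁ ℓ₂ ℓ₃) →
  let open OrderedField K in
  (k : ℕ) → 1 ℕ.≤ k →
  (ε : Carrier) (0<ε : 0# < ε) → ε < 1# /ℕ 2 →
  let δ  = ε /ℕ 2
      n₀ = fromℕ (2 ℕ.* k) ÷ ε [ 0<ε ]
  in
  (n : ℕ) (G : Graph n) →
  Free (cycle (2 ℕ.* k ℕ.+ 1)) G →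
  n₀ ≤ fromℕ n →
  (1# /ℕ 4 - δ) * (fromℕ n * fromℕ n) ≤ fromℕ (e G) →
  ∃[ D ] (D ⊆ G × Bipartite (G ∖ D) × fromℕ (e D) ≤ ε * (fromℕ n * fromℕ n))
-- An empty vertex set is impossible, since 4k ≤ n with k positive.
theorem4p8 K k@(suc _) _ ε 0<ε ε<½ zero G free n₀≤n dense =
  contradiction (4k≤n k ε<½ (m≤εn (2 ℕ.* k) n₀≤n)) λ ()
  where open OrderedFieldProperties.Threshold K 0<ε zero
theorem4p8 K k@(suc k′) _ ε 0<ε ε<½ n@(suc _) G free n₀≤n dense =
  uncut G v , proj₁ , uncut-bipartite G v ,
  D≤εn² {e (uncut G v)} {e G} k r 4k+r≡n (completed-square {D = e (uncut G v)} {e G} k r (≡.sym 4k+r≡n) averaged) 2k≤εn (n²≤4e+2εn² dense)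
  where
  open Combinatorics
  open OrderedFieldProperties.Threshold K 0<ε n
  2k≤εn = m≤εn (2 ℕ.* k) n₀≤n
  remainder = m≤n⇒∃[o]m+o≡n (4k≤n k ε<½ 2k≤εn)
  r = proj₁ remainder
  4k+r≡n = proj₂ remainder
  -- The argument of `e₂-N≤` is 2k - 1 in a form whose successor computes to `2 * k`: paths on 2k
  -- vertices are excluded and the cycle has `suc (2 * k)` vertices.
  average = ∃-uncut≤ G k (e₂-N≤ G (k′ ℕ.+ suc (k′ ℕ.+ 0))
    (≡.subst (λ m → Free (cycle m) G) (ℕₚ.+-comm (2 ℕ.* k) 1) free))
  v = proj₁ average
  averaged = proj₂ average
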